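{- Let $G$ be a connected triangle-free graph with at least two vertices. If $G\in\mathfrak{N}_{c}$, then $W_{c}(G)\leq |V(G)|+\Delta(G)-2$.
   Context: All graphs are finite, undirected, without loops or multiple edges. $\Delta(G)$ is the maximum degree of $G$ and $d_G(v)$ is the degree of the vertex $v$. For a positive integer $t$, an interval cyclic $t$-coloring of $G$ is a proper edge-coloring of $G$ with colors $1,\ldots,t$ such that all $t$ colors are used and, for each vertex $v$, the edges incident to $v$ are colored by $d_{G}(v)$ consecutive colors modulo $t$ (i.e. consecutive in the cyclic order $1,2,\ldots,t,1$). $\mathfrak{N}_{c}$ is the set of graphs having an interval cyclic $t$-coloring for some positive integer $t$. For $G\in\mathfrak{N}_{c}$, $W_{c}(G)$ is the greatest $t$ for which $G$ has an interval cyclic $t$-coloring. -}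

module Defs where

open import Data.Bool using (Bool; false; T)
open import Data.Fin using (Fin; toℕ)
open import Data.Fin.Subset using (Subset; ∣_∣)
open import Data.List using (map; allFin)
open import Data.List.Extrema.Nat using (max)
open import Data.Nat using (ℕ; _+_; _≤_; _<_; NonZero)
open import Data.Nat.DivMod using (_mod_)
open import Data.Product using (Σ; ∃; ∃-syntax; _×_)
open import Data.Vec using (tabulate)
open import Function.Bundles using (_⇔_)
open import Relation.Binary.Construct.Closure.ReflexiveTransitive using (Star)
open import Relation.Binary.PropositionalEquality using (_≡_; _≢_)
open import Relation.Nullary using (¬_)

-- Finite simple graphs on the n vertices Fin n.
record Graph (n : ℕ) : Set where
  field
    adj        : Fin n → Fin n → Bool
    adj-sym    : ∀ u v → adj u v ≡ adj v u
    adj-irrefl : ∀ v → adj v v ≡ false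

  infix 4 _~_
  _~_ : Fin n → Fin n → Set
  u ~ v = T (adj u v)

  neighbours : Fin n → Subset n
  neighbours v = tabulate (adj v)

  deg : Fin n → ℕ
  deg v = ∣ neighbours v ∣

  Δ : ℕ
  Δ = max 0 (map deg (allFin n))

  Connected : Set
  Connected = ∀ u v → Star _~_ u v

  TriangleFree : Set
  TriangleFree = ∀ {u v w} → u ~ v → v ~ w → ¬ (w ~ u)

-- The colours 1, …, t are represented by Fin t, i.e. by 0, …, t - 1.
record IntervalCyclicColouring {n} (G : Graph n) (t : ℕ) .{{_ : NonZero t}} : Set where
  open Graph G
  field
    colour     : ∀ {u v} → u ~ v → Fin t
    -- An edge has one colour, whichever way it is traversed.
    colour-sym : ∀ {u v} (e : u ~ v) (e′ : v ~ u) → colour e ≡ colour e′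
    proper     : ∀ {u v w} (e : u ~ v) (e′ : u ~ w) → v ≢ w → colour e ≢ colour e′
    surjective : ∀ k → ∃[ u ] ∃[ v ] Σ (u ~ v) λ e → colour e ≡ k

  _∈Spectrum_ : Fin t → Fin n → Set
  k ∈Spectrum v = ∃[ w ] Σ (v ~ w) λ e → colour e ≡ k

  field
    -- The colours at v are exactly s, s + 1, …, s + deg v - 1 modulo t, for some s.
    consecutive : ∀ v → ∃[ s ] (∀ k →
      k ∈Spectrum v ⇔ (∃[ i ] (i < deg v × k ≡ (toℕ {t} s + i) mod t)))

HasIntervalCyclicColouring : ∀ {n} → Graph n → ℕ → Set
HasIntervalCyclicColouring G t =
  Σ (NonZero t) λ t≢0 → IntervalCyclicColouring G t {{t≢0}}

𝔑c : ∀ {n} → Graph n → Set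
𝔑c G = ∃[ t ] HasIntervalCyclicColouring G t

-- IsWc G w says that W_c(G) = w.
IsWc : ∀ {n} → Graph n → ℕ → Set
IsWc G w = HasIntervalCyclicColouring G w
         × (∀ t → HasIntervalCyclicColouring G t → t ≤ w)

{-# OPTIONS --safe #-}
module Submission where

-- Write n for the number of vertices, D for the maximum degree and t for the number of
-- colours.  If t ≤ D the bound is clear.  Otherwise delete every edge whose colour lies
-- outside the window 0, …, t - D.  The colours at a vertex form a cyclic interval of length
-- at most D, which is too short to leave the window at t - D, pass over all of the D - 1
-- deleted colours, and enter it again at 0; so its trace on the window is convex
-- (`cyclic-convex`).  What is left is a triangle-free graph, possibly disconnected, properly
-- coloured by all of m = t - D + 1 colours, with convex sets of colours at the vertices.
-- Such a colouring has m + 1 ≤ n (`colours<vertices`), which is the claim.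
--
-- For a connected piece, take an edge pv of colour c and a colour M occurring in the same
-- component, and walk from v towards the colour M along a shortest path, always choosing
-- among the admissible next edges one of least colour.  Suppose that the walk enters v by
-- colour a and leaves it by colour b > a.  By convexity v has neighbours along all colours
-- strictly between a and b, and by the choice of b none of them is closer to the target
-- than v is.  Hence such a neighbour x cannot be counted again further on: at the next
-- vertex of the walk this would give a triangle, and at later ones x would be too close to
-- the target.  So M - c + 2 distinct vertices arise (`climb`, `component`).
--
-- Components are combined by recursion on m - M (`packing`): collect vertices for the
-- colours c, …, M and for the colours from M + 1 upwards.  Either the two collections are
-- disjoint, or a common vertex shows that a colour larger than M occurs in the component
-- of pv, and M is replaced by that colour.

open import Data.Bool using (T)
open import Data.Bool.Properties using (T?; T-irrelevant)
open import Data.Empty using (⊥; ⊥-elim)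
open import Data.Fin using (Fin; toℕ; zero; suc; fromℕ<) renaming (_≟_ to _≟ᶠ_)
open import Data.Fin.Properties using (any?; injective⇒≤; toℕ<n; toℕ-fromℕ<; toℕ-injective)
open import Data.List using (List; []; _∷_; _++_; length; lookup; map; allFin)
open import Data.List.Extrema.Nat using (xs≤max)
open import Data.List.Membership.Propositional using (_∈_; find; lose)
import Data.List.Membership.DecPropositional as DecMembership
open import Data.List.Membership.Propositional.Properties using (∈-allFin; ∈-lookup; ∈-map⁺)
open import Data.List.Properties using (length-++)
open import Data.List.Relation.Unary.All as All using (All; []; _∷_)
open import Data.List.Relation.Unary.All.Properties using (++⁺)
open import Data.List.Relation.Unary.AllPairs using ([]; _∷_)
import Data.List.Relation.Unary.Any as Any
open import Data.List.Relation.Unary.Unique.Propositional using (Unique)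
import Data.List.Relation.Unary.Unique.Propositional.Properties as Unique
open import Data.Nat using (ℕ; zero; suc; _+_; _∸_; _≤_; _<_; NonZero; z≤n; s≤s; _<?_; _≟_)
open import Data.Nat.DivMod using (_%_; _mod_; m<n⇒m%n≡m; [m+n]%n≡m%n; m%n<n)
open import Data.Nat.Properties hiding (_<?_; _≟_)
open import Data.Product using (∃-syntax; Σ-syntax; _×_; _,_; proj₁; proj₂)
open import Data.Sum using (_⊎_; inj₁; inj₂; [_,_]′)
open import Function using (_∘_)
open import Function.Bundles using (module Equivalence)
open import Relation.Binary.Construct.Closure.ReflexiveTransitive
  using (Star; ε; _◅_; _◅◅_; reverse)
open import Relation.Binary.PropositionalEquality
  using (_≡_; _≢_; refl; sym; trans; cong; subst)
open import Relation.Nullary using (¬_; Dec; yes; no; contradiction)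
open import Relation.Nullary.Decidable using (map′; _⊎-dec_; _×-dec_)
open import Defs

-- Lists without repetitions, and least witnesses

unique-lookup : ∀ {A : Set} {xs : List A} → Unique xs →
  ∀ {i j} → lookup xs i ≡ lookup xs j → i ≡ j
unique-lookup (_ ∷ _)    {zero}  {zero}  _  = refl
unique-lookup (x∉ ∷ _)   {zero}  {suc j} eq = contradiction eq (All.lookup x∉ (∈-lookup j))
unique-lookup (x∉ ∷ _)   {suc i} {zero}  eq = contradiction (sym eq) (All.lookup x∉ (∈-lookup i))
unique-lookup (_ ∷ uniq) {suc i} {suc j} eq = cong suc (unique-lookup uniq eq)

unique-length : ∀ {n} {xs : List (Fin n)} → Unique xs → length xs ≤ n
unique-length uniq = injective⇒≤ (unique-lookup uniq)

least : ∀ {P : ℕ → Set} → (∀ k → Dec (P k)) → ∀ {k} → P k →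
  ∃[ b ] (P b × (∀ {j} → j < b → ¬ P j))
least {P} P? {k} Pk = search k 0 (subst P (sym (+-identityʳ k)) Pk) (λ ())
  where
  search : ∀ fuel b → P (fuel + b) → (∀ {j} → j < b → ¬ P j) →
    ∃[ b ] (P b × (∀ {j} → j < b → ¬ P j))
  search zero       b Pb below = b , Pb , below
  search (suc fuel) b Pk below with P? b
  ... | yes Pb = b , Pb , below
  ... | no ¬Pb = search fuel (suc b) (subst P (sym (+-suc fuel b)) Pk) below′
    where
    below′ : ∀ {j} → j < suc b → ¬ P j
    below′ j<1+b with m≤n⇒m<n∨m≡n (≤-pred j<1+b)
    ... | inj₁ j<b  = below j<b
    ... | inj₂ refl = ¬Pb

-- Convex colourings of triangle-free graphs

-- A triangle-free graph on Fin n, not necessarily connected, with a proper edge-colouring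
-- by all of the colours 0, …, m - 1 such that the colours at each vertex form an interval
-- of natural numbers.  Edge k u v says that uv is an edge of colour k.  Irreflexivity of
-- adjacency is a special case of triangle-freeness.
record ConvexColouring (n m : ℕ) : Set₁ where
  field
    Edge          : ℕ → Fin n → Fin n → Set
    Edge?         : ∀ k u v → Dec (Edge k u v)
    edge-sym      : ∀ {k u v} → Edge k u v → Edge k v u
    one-colour    : ∀ {k l u v} → Edge k u v → Edge l u v → k ≡ l
    proper        : ∀ {k u v w} → Edge k u v → Edge k u w → v ≡ w
    triangle-free : ∀ {i j k u v w} → Edge i u v → Edge j v w → Edge k w u → ⊥
    convex        : ∀ {a b k v x y} → Edge a v x → Edge b v y → a < k → k ≤ b →
                    ∃[ z ] Edge k v z
    palette       : ∀ {k u v} → Edge k u v → k < m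
    onto          : ∀ {k} → k < m → ∃[ u ] ∃[ v ] Edge k u v

module Convex {n m : ℕ} (C : ConvexColouring n m) where
  open ConvexColouring C
  open DecMembership (_≟ᶠ_ {n}) using (_∈?_)

  Adj : Fin n → Fin n → Set
  Adj u v = ∃[ k ] Edge k u v

  Adj? : ∀ u v → Dec (Adj u v)
  Adj? u v = map′ (λ (k , _ , e) → k , e) (λ (k , e) → k , palette e , e)
                  (anyUpTo? (λ k → Edge? k u v) m)

  irreflexive : ∀ {k v} → ¬ Edge k v v
  irreflexive e = triangle-free e e e

  Adj-sym : ∀ {u v} → Adj u v → Adj v u
  Adj-sym (k , e) = k , edge-sym e

  -- v is incident with an edge of colour k.
  Sees : ℕ → Fin n → Set
  Sees k v = ∃[ w ] Edge k v w

  Sees? : ∀ k v → Dec (Sees k v)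
  Sees? k v = any? (Edge? k v)

  -- Within M d v says that v is at distance less than d from a vertex that sees M; so
  -- the distance is exactly d when Within M (suc d) v holds and Within M d v fails.
  Within : ℕ → ℕ → Fin n → Set
  Within M zero    v = ⊥
  Within M (suc d) v = Sees M v ⊎ (∃[ w ] (Adj v w × Within M d w))

  Within? : ∀ M d v → Dec (Within M d v)
  Within? M zero    v = no λ ()
  Within? M (suc d) v = Sees? M v ⊎-dec any? λ w → Adj? v w ×-dec Within? M d w

  Within-suc : ∀ {M} d {v} → Within M d v → Within M (suc d) v
  Within-suc (suc d) (inj₁ s)            = inj₁ s
  Within-suc (suc d) (inj₂ (w , vw , r)) = inj₂ (w , vw , Within-suc d r)

  Star⇒Within : ∀ {M u v} → Star Adj u v → Sees M v → ∃[ d ] Within M d u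
  Star⇒Within ε         s = 1 , inj₁ s
  Star⇒Within (uw ◅ wv) s with Star⇒Within wv s
  ... | d , r = suc d , inj₂ (_ , uw , r)

  -- Neighbours of v, one along each colour strictly between a and h.
  fan : ∀ {a b v p z} → Edge a v p → Edge b v z → ∀ h → h ≤ suc b →
    ∃[ X ] (Unique X × h ∸ suc a ≤ length X ×
            All (λ x → ∃[ k ] (a < k × k < h × Edge k v x)) X)
  fan vp vz zero    _     = [] , [] , z≤n , []
  fan {a} vp vz (suc h) 1+h≤1+b with fan vp vz h (<⇒≤ 1+h≤1+b) | a <? h
  ... | _ | no a≮h = [] , [] , ≤-reflexive (m≤n⇒m∸n≡0 (≮⇒≥ a≮h)) , []
  ... | X , uniq , len , cols | yes a<h with convex vp vz a<h (≤-pred 1+h≤1+b)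
  ... | y , vy = y ∷ X
    , All.map (λ { (k , _ , k<h , vx) refl → <⇒≢ k<h (one-colour vx vy) }) cols ∷ uniq
    , ≤-trans (≤-reflexive (+-∸-assoc 1 a<h)) (s≤s len)
    , (h , a<h , ≤-refl , vy)
      ∷ All.map (λ (k , a<k , k<h , vx) → k , a<k , m<n⇒m<1+n k<h , vx) cols

  -- For a step from colour a to colour b, with M still ahead: the x vertices inside the
  -- step, the next vertex, and the l vertices of the rest of the walk account for M - a.
  step-bound : ∀ a b M {x l} → b ∸ suc a ≤ x → M ∸ b ≤ l → M ∸ a ≤ suc (x + l)
  step-bound a b M {x} {l} x≥ l≥ = m≤n+o⇒m∸n≤o M a (begin
    M                                ≤⟨ m≤n+m∸n M b ⟩
    b + (M ∸ b)                      ≤⟨ +-mono-≤ (m≤n+m∸n b (suc a)) l≥ ⟩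
    suc a + (b ∸ suc a) + l          ≤⟨ +-monoˡ-≤ l (+-monoʳ-≤ (suc a) x≥) ⟩
    suc a + x + l                    ≡⟨ +-assoc (suc a) x l ⟩
    suc (a + (x + l))                ≡⟨ +-suc a (x + l) ⟨
    a + suc (x + l)                  ∎)
    where open ≤-Reasoning

  -- The constraints on a vertex y collected by the walk that enters v from p, where v is at
  -- distance d from the colour M.  If p is at distance d + 1, then a neighbour x of p that is
  -- no closer to the target than p violates them: its distance exceeds d, and it is not
  -- adjacent to v.  This keeps the vertices collected at successive steps apart.
  Collected : ℕ → ℕ → Fin n → Fin n → Fin n → Set
  Collected M d p v y =
    y ≢ v × y ≢ p × (Within M (suc d) y ⊎ Adj v y) × Star Adj v y

  -- At least M - a vertices are collected after v has been entered by colour a.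
  climb : ∀ M d {p v a} → Edge a v p → Within M (suc d) v →
    ¬ Within M d v → ¬ Within M d p →
    ∃[ L ] (Unique L × M ∸ a ≤ length L × All (Collected M d p v) L)
  -- The walk has arrived: the neighbours of v along the colours a + 1, …, M are enough.
  climb M d {p} {v} {a} vp (inj₁ (z , vz)) _ _ with fan vp vz (suc M) ≤-refl
  ... | X , uniq , len , cols = X , uniq , len , All.map collected cols
    where
    collected : ∀ {x} → ∃[ k ] (a < k × k < suc M × Edge k v x) → Collected M d p v x
    collected (k , a<k , _ , vx) =
        (λ { refl → irreflexive vx })
      , (λ { refl → <⇒≢ a<k (one-colour vp vx) })
      , inj₂ (k , vx) , (k , vx) ◅ ε
  climb M (suc d) {p} {v} {a} vp (inj₂ (w₀ , (b₀ , vw₀) , near₀)) v-far p-far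
    -- Among the edges that lead closer to the target, take one of least colour b.
    with least (λ b → any? λ w → Edge? b v w ×-dec Within? M (suc d) w) (w₀ , vw₀ , near₀)
  ... | b , (w , vw , near) , minimal
    with fan vp vw b (n≤1+n b)
       | climb M d (edge-sym vw) near (λ r → v-far (inj₂ (w , (b , vw) , r)))
                                      (v-far ∘ Within-suc d)
  ... | X , X-uniq , X-len , X-cols | L , L-uniq , L-len , L-coll =
      w ∷ X ++ L
    , ++⁺ (All.map w≢X X-cols) (All.map (λ (y≢w , _) → y≢w ∘ sym) L-coll)
      ∷ Unique.++⁺ X-uniq L-uniq disjoint
    , ≤-trans (step-bound a b M X-len L-len) (≤-reflexive (cong suc (sym (length-++ X))))
    , w-coll ∷ ++⁺ (All.map X-coll X-cols) (All.map L-coll′ L-coll)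
    where
    InFan : Fin n → Set
    InFan x = ∃[ k ] (a < k × k < b × Edge k v x)

    w≢X : ∀ {x} → InFan x → w ≢ x
    w≢X (k , _ , k<b , vx) refl = <⇒≢ k<b (one-colour vx vw)

    disjoint : ∀ {x} → ¬ (x ∈ X × x ∈ L)
    disjoint (x∈X , x∈L) with All.lookup X-cols x∈X | All.lookup L-coll x∈L
    ... | k , _ , k<b , vx | _ , _ , inj₁ r , _        = minimal k<b (_ , vx , r)
    ... | k , _ , k<b , vx | _ , _ , inj₂ (_ , wx) , _ = triangle-free vw wx (edge-sym vx)

    w-coll : Collected M (suc d) p v w
    w-coll = (λ { refl → irreflexive vw }) , (λ { refl → p-far near })
           , inj₂ (b , vw) , (b , vw) ◅ ε

    X-coll : ∀ {x} → InFan x → Collected M (suc d) p v x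
    X-coll (k , a<k , _ , vx) =
        (λ { refl → irreflexive vx })
      , (λ { refl → <⇒≢ a<k (one-colour vp vx) })
      , inj₂ (k , vx) , (k , vx) ◅ ε

    L-coll′ : ∀ {y} → Collected M d v w y → Collected M (suc d) p v y
    L-coll′ (_ , y≢v , inj₁ r , path) =
      y≢v , (λ { refl → p-far r }) , inj₁ (Within-suc (suc d) r) , (b , vw) ◅ path
    L-coll′ (_ , y≢v , inj₂ (_ , wy) , path) =
        y≢v
      , (λ { refl → triangle-free vw wy (edge-sym vp) })
      , inj₁ (inj₂ (w , (_ , edge-sym wy) , near)) , (b , vw) ◅ path

  -- A component in which the colours c and M occur has at least M - c + 2 vertices.
  component : ∀ {c M p v z} → Edge c v p → Star Adj v z → Sees M z →
    ∃[ U ] (Unique U × suc (suc (M ∸ c)) ≤ length U × All (Star Adj v) U)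
  component {c} {M} {p} {v} vp path s
    -- The walk starts at the end of the edge vp that is nearer to the target.
    with least (λ d → Within? M d v ⊎-dec Within? M d p) (inj₁ (proj₂ (Star⇒Within path s)))
  ... | zero , inj₁ () , _
  ... | zero , inj₂ () , _
  ... | suc d , nearer , minimal = [ from vp below , swapped ]′ nearer
    where
    below : ¬ (Within M d v ⊎ Within M d p)
    below = minimal ≤-refl

    from : ∀ {p v} → Edge c v p → ¬ (Within M d v ⊎ Within M d p) → Within M (suc d) v →
      ∃[ U ] (Unique U × suc (suc (M ∸ c)) ≤ length U × All (Star Adj v) U)
    from {p} {v} vp far r with climb M d vp r (far ∘ inj₁) (far ∘ inj₂)
    ... | L , uniq , len , coll =
        p ∷ v ∷ L
      , ((λ { refl → irreflexive vp }) ∷ All.map (λ (_ , y≢p , _) → y≢p ∘ sym) coll)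
        ∷ All.map (λ (y≢v , _) → y≢v ∘ sym) coll ∷ uniq
      , s≤s (s≤s len)
      , ((c , vp) ◅ ε) ∷ ε ∷ All.map (λ (_ , _ , _ , path) → path) coll

    swapped : Within M (suc d) p →
      ∃[ U ] (Unique U × suc (suc (M ∸ c)) ≤ length U × All (Star Adj v) U)
    swapped r with from (edge-sym vp) (below ∘ [ inj₂ , inj₁ ]′) r
    ... | U , uniq , len , paths = U , uniq , len , All.map ((c , vp) ◅_) paths

  -- Some colour k ≥ c occurs in the component of y.
  Above : ℕ → Fin n → Set
  Above c y = ∃[ z ] ∃[ k ] (c ≤ k × Star Adj y z × Sees k z)

  joins : ∀ {c v p y} → Edge c v p → Star Adj v y → Above c y
  joins {c} {v} {p} vp vy = v , c , ≤-refl , reverse Adj-sym vy , p , vp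

  -- There are at least m - c + 1 vertices in the components in which some colour from c
  -- upwards occurs.  Here M is a colour known to occur in the component of an edge vp of
  -- colour c; every recursive call concerns a larger M, and fuel bounds m - M.
  packing : ∀ fuel {c M p v z} → m ≤ M + fuel → c ≤ M →
    Edge c v p → Star Adj v z → Sees M z →
    ∃[ U ] (Unique U × suc m ∸ c ≤ length U × All (Above c) U)
  packing zero {M = M} m≤M+0 _ _ _ (_ , zw) =
    contradiction (≤-trans m≤M+0 (≤-reflexive (+-identityʳ M))) (<⇒≱ (palette zw))
  packing (suc fuel) {c} {M} {p} {v} m≤ c≤M vp path s
    with component vp path s | suc M <? m
  ... | U , uniq , len , paths | no M+1≮m = U , uniq , enough , All.map (joins vp) paths
    where
    enough : suc m ∸ c ≤ length U
    enough = ≤-trans (∸-monoˡ-≤ c (s≤s (≮⇒≥ M+1≮m)))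
             (≤-trans (≤-reflexive (+-∸-assoc 2 c≤M)) len)
  ... | U , uniq , len , paths | yes M+1<m
    with onto M+1<m
  ... | v′ , p′ , v′p′
    with packing fuel (≤-trans m≤ (≤-reflexive (+-suc M fuel))) ≤-refl v′p′ ε (p′ , v′p′)
  ... | U′ , uniq′ , len′ , above′ with Any.any? (_∈? U′) U
  ... | no disjoint =
      U ++ U′
    , Unique.++⁺ uniq uniq′ (λ (y∈U , y∈U′) → disjoint (lose y∈U y∈U′))
    , enough
    , ++⁺ (All.map (joins vp) paths)
          (All.map (λ (z , k , M<k , rest) → z , k , ≤-trans c≤M (<⇒≤ M<k) , rest) above′)
    where
    open ≤-Reasoning
    enough : suc m ∸ c ≤ length (U ++ U′)
    enough = m≤n+o⇒m∸n≤o (suc m) c (begin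
      suc m                                ≤⟨ s≤s (m≤n+m∸n m M) ⟩
      suc (M + (m ∸ M))                    ≤⟨ s≤s (+-monoˡ-≤ (m ∸ M) (m≤n+m∸n M c)) ⟩
      suc (c + (M ∸ c) + (m ∸ M))          ≡⟨ cong suc (+-assoc c (M ∸ c) (m ∸ M)) ⟩
      suc (c + ((M ∸ c) + (m ∸ M)))        ≡⟨ +-suc c _ ⟨
      c + (suc (M ∸ c) + (m ∸ M))          ≤⟨ +-monoʳ-≤ c (+-mono-≤ (<⇒≤ len) len′) ⟩
      c + (length U + length U′)           ≡⟨ cong (c +_) (length-++ U) ⟨
      c + length (U ++ U′)                 ∎)
  -- A common vertex shows that a colour M′ > M occurs in the component of vp.
  ... | yes common with find common
  ... | y , y∈U , y∈U′ with All.lookup above′ y∈U′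
  ... | z′ , M′ , M<M′ , yz′ , s′ =
    packing fuel (≤-trans m≤ (≤-trans (≤-reflexive (+-suc M fuel)) (+-monoˡ-≤ fuel M<M′)))
      (≤-trans c≤M (<⇒≤ M<M′)) vp (All.lookup paths y∈U ◅◅ yz′) s′

  colours<vertices : 0 < m → m < n
  colours<vertices 0<m with onto 0<m
  ... | v , p , vp with packing m ≤-refl z≤n vp ε (p , vp)
  ... | U , uniq , len , _ = ≤-trans len (unique-length uniq)

-- Cyclic intervals

%-wrap : ∀ x t .{{_ : NonZero t}} → x < t + t → x % t ≡ x ⊎ x % t + t ≡ x
%-wrap x t x<2t with x <? t
... | yes x<t = inj₁ (m<n⇒m%n≡m x<t)
... | no x≮t  = inj₂ (trans (cong (_+ t) eq) x∸t+t)
  where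
  x∸t+t : x ∸ t + t ≡ x
  x∸t+t = m∸n+n≡m (≮⇒≥ x≮t)
  eq : x % t ≡ x ∸ t
  eq = trans (cong (_% t) (sym x∸t+t))
       (trans ([m+n]%n≡m%n (x ∸ t) t)
              (m<n⇒m%n≡m (+-cancelʳ-< t (x ∸ t) t (subst (_< t + t) (sym x∸t+t) x<2t))))

-- A cyclic interval of at most D colours, starting at s, meets 0, …, t - D in a convex set,
-- because it is too short to pass from t - D over t - D + 1, …, t - 1 and on to 0.  The colours
-- at its positions i and j are the ends of the range that contains k.
cyclic-convex : ∀ {t} .{{_ : NonZero t}} D s {i j k} → D < t → s < t → i < D → j < D →
  (s + i) % t < k → k ≤ (s + j) % t → (s + j) % t ≤ t ∸ D →
  ∃[ l ] (l ≤ j × k ≡ (s + l) % t)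
cyclic-convex {t} D s {i} {j} {k} D<t s<t i<D j<D a<k k≤b b≤t∸D = by-position (s ≤? k)
  where
  k<t : k < t
  k<t = ≤-<-trans k≤b (m%n<n (s + j) t)

  wrapped : ∀ {l} → l < D → (s + l) % t ≡ s + l ⊎ (s + l) % t + t ≡ s + l
  wrapped l<D = %-wrap _ t (+-mono-< s<t (<-trans l<D D<t))

  by-position : Dec (s ≤ k) → ∃[ l ] (l ≤ j × k ≡ (s + l) % t)
  by-position (yes s≤k) =
      k ∸ s
    , m≤n+o⇒m∸n≤o k s ([ (λ b≡ → ≤-trans k≤b (≤-reflexive b≡)) , absurd ]′ (wrapped j<D))
    , sym (trans (cong (_% t) (m+[n∸m]≡n s≤k)) (m<n⇒m%n≡m k<t))
    where
    absurd : (s + j) % t + t ≡ s + j → k ≤ s + j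
    absurd b+t≡ = contradiction (≤-trans s≤k k≤b) (<⇒≱
      (+-cancelʳ-< t _ s (subst (_< s + t) (sym b+t≡) (+-monoʳ-< s (<-trans j<D D<t)))))
  by-position (no s≰k) =
      k + t ∸ s
    , m≤n+o⇒m∸n≤o (k + t) s ([ (λ b≡ → ⊥-elim (crossing b≡ (wrapped i<D)))
                             , (λ b+t≡ → ≤-trans (+-monoˡ-≤ t k≤b) (≤-reflexive b+t≡))
                             ]′ (wrapped j<D))
    , sym (trans (cong (_% t) (m+[n∸m]≡n (≤-trans (<⇒≤ s<t) (m≤n+m t k))))
          (trans ([m+n]%n≡m%n k t) (m<n⇒m%n≡m k<t)))
    where
    crossing : (s + j) % t ≡ s + j → ¬ ((s + i) % t ≡ s + i ⊎ (s + i) % t + t ≡ s + i)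
    crossing b≡ (inj₁ a≡)   =
      s≰k (≤-trans (m≤m+n s i) (≤-trans (≤-reflexive (sym a≡)) (<⇒≤ a<k)))
    crossing b≡ (inj₂ a+t≡) = <-irrefl refl (begin-strict
      t                  ≤⟨ m≤n+m t _ ⟩
      (s + i) % t + t    ≡⟨ a+t≡ ⟩
      s + i              <⟨ +-monoʳ-< s i<D ⟩
      s + D              ≤⟨ +-monoˡ-≤ D (m≤m+n s j) ⟩
      s + j + D          ≡⟨ cong (_+ D) b≡ ⟨
      (s + j) % t + D    ≤⟨ +-monoˡ-≤ D b≤t∸D ⟩
      t ∸ D + D          ≡⟨ m∸n+n≡m (<⇒≤ D<t) ⟩
      t                  ∎)
      where open ≤-Reasoning

-- Restriction of an interval cyclic colouring to a window of colours

module _ {n} (G : Graph n) where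
  open Graph G

  deg≤Δ : ∀ v → deg v ≤ Δ
  deg≤Δ v = All.lookup (xs≤max 0 (map deg (allFin n))) (∈-map⁺ deg (∈-allFin v))

  -- All colours are used, so there is an edge.
  Δ-positive : ∀ {t} .{{_ : NonZero t}} → IntervalCyclicColouring G t → 0 < Δ
  Δ-positive {suc t} α with surjective zero
    where open IntervalCyclicColouring α
  ... | u , v , e , _
    with Equivalence.to (proj₂ (consecutive u) (colour e)) (v , e , refl)
    where open IntervalCyclicColouring α
  ... | _ , i<deg , _ = ≤-trans (s≤s z≤n) (<-≤-trans i<deg (deg≤Δ u))

  -- The edges of colour at most t - Δ.  As Δ is positive, all t - Δ + 1 of these colours exist.
  window : TriangleFree → ∀ {t} .{{_ : NonZero t}} → 0 < Δ → Δ < t →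
    IntervalCyclicColouring G t → ConvexColouring n (suc (t ∸ Δ))
  window no-triangle {t} 0<Δ Δ<t α = record
    { Edge          = Edge
    ; Edge?         = Edge?
    ; edge-sym      = λ {k} {u} {v} (e , eq , k<m) →
        let e′ = subst T (adj-sym u v) e in
        e′ , trans (cong toℕ (colour-sym e′ e)) eq , k<m
    ; one-colour    = λ (e , eq , _) (e′ , eq′ , _) →
        trans (sym eq) (trans (cong (toℕ ∘ colour) (T-irrelevant e e′)) eq′)
    ; proper        = same-end
    ; triangle-free = λ (e , _) (e′ , _) (e″ , _) → no-triangle e e′ e″
    ; convex        = convex
    ; palette       = λ (_ , _ , k<m) → k<m
    ; onto          = onto
    }
    where
    open IntervalCyclicColouring α

    Edge : ℕ → Fin n → Fin n → Set
    Edge k u v = Σ[ e ∈ u ~ v ] (toℕ (colour e) ≡ k × k < suc (t ∸ Δ))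

    Edge? : ∀ k u v → Dec (Edge k u v)
    Edge? k u v with T? (adj u v)
    ... | no ¬e = no (¬e ∘ proj₁)
    ... | yes e = map′ (e ,_) same (toℕ (colour e) ≟ k ×-dec k <? suc (t ∸ Δ))
      where
      same : Edge k u v → toℕ (colour e) ≡ k × k < suc (t ∸ Δ)
      same (e′ , rest) with T-irrelevant e e′
      ... | refl = rest

    same-end : ∀ {k u v w} → Edge k u v → Edge k u w → v ≡ w
    same-end {v = v} {w} (e , eq , _) (e′ , eq′ , _) with v ≟ᶠ w
    ... | yes v≡w = v≡w
    ... | no v≢w  = contradiction (toℕ-injective (trans eq (sym eq′))) (proper e e′ v≢w)

    onto : ∀ {k} → k < suc (t ∸ Δ) → ∃[ u ] ∃[ v ] Edge k u v
    onto {k} k<m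
      with surjective (fromℕ< (≤-<-trans (≤-pred k<m) (∸-monoʳ-< {o = 0} 0<Δ (<⇒≤ Δ<t))))
    ... | u , v , e , eq = u , v , e , trans (cong toℕ eq) (toℕ-fromℕ< _) , k<m

    convex : ∀ {a b k v x y} → Edge a v x → Edge b v y → a < k → k ≤ b → ∃[ z ] Edge k v z
    convex {k = k} {v} {x} {y} (e , refl , _) (e′ , refl , b<m) a<k k≤b
      with consecutive v
    ... | s , spec
      with Equivalence.to (spec (colour e)) (x , e , refl)
         | Equivalence.to (spec (colour e′)) (y , e′ , refl)
    ... | i , i<deg , a≡ | j , j<deg , b≡
      with cyclic-convex {t} Δ (toℕ s) Δ<t (toℕ<n s)
             (<-≤-trans i<deg (deg≤Δ v)) (<-≤-trans j<deg (deg≤Δ v))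
             (subst (_< k) (value a≡) a<k) (subst (k ≤_) (value b≡) k≤b)
             (subst (_≤ t ∸ Δ) (value b≡) (≤-pred b<m))
      where
      value : ∀ {c : Fin t} {x} → c ≡ x mod t → toℕ c ≡ x % t
      value c≡ = trans (cong toℕ c≡) (toℕ-fromℕ< _)
    ... | l , l≤j , k≡
      with Equivalence.from (spec ((toℕ s + l) mod t)) (l , ≤-<-trans l≤j j<deg , refl)
    ... | z , e″ , eq =
      z , e″ , trans (cong toℕ eq) (trans (toℕ-fromℕ< _) (sym k≡)) , ≤-<-trans k≤b b<m

theorem10 : ∀ (n : ℕ) → 2 ≤ n → (G : Graph n) → Graph.Connected G → Graph.TriangleFree G →
    𝔑c G → ∀ (w : ℕ) → IsWc G w → w ≤ n + Graph.Δ G ∸ 2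
theorem10 n 2≤n G _ no-triangle _ t ((t≢0 , α) , _) = begin
  t                ≤⟨ m≤n+m∸n t Δ ⟩
  Δ + (t ∸ Δ)      ≤⟨ +-monoʳ-≤ Δ excess ⟩
  Δ + (n ∸ 2)      ≡⟨ +-∸-assoc Δ 2≤n ⟨
  Δ + n ∸ 2        ≡⟨ cong (_∸ 2) (+-comm Δ n) ⟩
  n + Δ ∸ 2        ∎
  where
  open ≤-Reasoning
  open Graph G using (Δ)
  instance _ = t≢0

  excess : t ∸ Δ ≤ n ∸ 2
  excess with Δ <? t
  ... | no Δ≮t  = ≤-trans (≤-reflexive (m≤n⇒m∸n≡0 (≮⇒≥ Δ≮t))) z≤n
  ... | yes Δ<t = ∸-monoˡ-≤ 2 (Convex.colours<vertices
                    (window G no-triangle (Δ-positive G α) Δ<t α) (s≤s z≤n))
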